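{- Let $G$ be a connected, reduced bipartite graph with partite sets of sizes $m$ and $n$, where $m\le n$. Then: (1) if $n\ge m+3$, then $\mathcal{R}(G)\le \lceil \frac{m+n}{4}\rceil$; (2) if $m$ is even and $n\in\{m+1,m+2\}$, then $\mathcal{R}(G)\le \lceil \frac{m+n}{4}\rceil$.
   Context: Letters $x,y$ alternate in a word $w$ if the subsequence of $w$ consisting of occurrences of $x$ and $y$ is $xyxy\cdots$ or $yxyx\cdots$. A word $w$ over the vertex set of a graph (containing every vertex) represents the graph if two vertices are adjacent iff they alternate in $w$. A word is $k$-uniform if each letter occurs exactly $k$ times. The representation number $\mathcal{R}(G)$ is the least $k$ such that $G$ has a $k$-uniform word representing it. A graph is reduced if no two vertices have the same neighborhood. -}

module Defs where

open import Data.Nat using (ℕ; zero; suc; _≤_; _+_)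
open import Data.Bool using (Bool; true; false)
open import Data.Fin using (Fin)
open import Data.Sum using (_⊎_; inj₁; inj₂)
open import Data.Product using (Σ; _×_; ∃; ∃-syntax)
open import Data.List using (List; []; _∷_; filter; length)
open import Data.List.Membership.Propositional using (_∈_)
open import Relation.Binary.PropositionalEquality using (_≡_; _≢_)
open import Relation.Binary.Definitions using (DecidableEquality)
open import Relation.Nullary using (¬_; Dec; yes; no)
open import Relation.Nullary.Decidable using (_⊎-dec_)
open import Function.Bundles using (_⇔_)

record Graph (V : Set) : Set where
  field
    adj   : V → V → Bool
    sym   : ∀ x y → adj x y ≡ adj y x
    irrefl : ∀ x → adj x x ≡ false

open Graph public

data Reachable {V : Set} (G : Graph V) : V → V → Set where
  here : ∀ {x} → Reachable G x x
  step : ∀ {x y z} → adj G x y ≡ true → Reachable G y z → Reachable G x z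

Connected : {V : Set} → Graph V → Set
Connected G = ∀ x y → Reachable G x y

Reduced : {V : Set} → Graph V → Set
Reduced G = ∀ x y → (∀ z → adj G x z ≡ adj G y z) → x ≡ y

BiVertex : ℕ → ℕ → Set
BiVertex m n = Fin m ⊎ Fin n

biAdj : ∀ {m n} → (Fin m → Fin n → Bool) → BiVertex m n → BiVertex m n → Bool
biAdj B (inj₁ a) (inj₁ a′) = false
biAdj B (inj₁ a) (inj₂ b)  = B a b
biAdj B (inj₂ b) (inj₁ a)  = B a b
biAdj B (inj₂ b) (inj₂ b′) = false

biSym : ∀ {m n} (B : Fin m → Fin n → Bool) → ∀ x y → biAdj B x y ≡ biAdj B y x
biSym B (inj₁ a) (inj₁ a′) = Relation.Binary.PropositionalEquality.refl
biSym B (inj₁ a) (inj₂ b)  = Relation.Binary.PropositionalEquality.refl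
biSym B (inj₂ b) (inj₁ a)  = Relation.Binary.PropositionalEquality.refl
biSym B (inj₂ b) (inj₂ b′) = Relation.Binary.PropositionalEquality.refl

biIrrefl : ∀ {m n} (B : Fin m → Fin n → Bool) → ∀ x → biAdj B x x ≡ false
biIrrefl B (inj₁ a) = Relation.Binary.PropositionalEquality.refl
biIrrefl B (inj₂ b) = Relation.Binary.PropositionalEquality.refl

BipartiteGraph : ∀ {m n} → (Fin m → Fin n → Bool) → Graph (BiVertex m n)
BipartiteGraph B = record { adj = biAdj B ; sym = biSym B ; irrefl = biIrrefl B }

module _ {V : Set} (_≟_ : DecidableEquality V) where

  data NoRepeat : List V → Set where
    nil  : NoRepeat []
    one  : ∀ x → NoRepeat (x ∷ [])
    cons : ∀ {x y w} → x ≢ y → NoRepeat (y ∷ w) → NoRepeat (x ∷ y ∷ w)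

  restrict : V → V → List V → List V
  restrict x y w = filter (λ z → (z ≟ x) ⊎-dec (z ≟ y)) w

  -- x and y alternate in w: the restricted subsequence is xyxy… or yxyx…
  Alternate : V → V → List V → Set
  Alternate x y w = NoRepeat (restrict x y w)

  occ : V → List V → ℕ
  occ x w = length (filter (_≟ x) w)

  Uniform : ℕ → List V → Set
  Uniform k w = ∀ x → occ x w ≡ k

  Represents : Graph V → List V → Set
  Represents G w = (∀ x → x ∈ w)
                 × (∀ x y → x ≢ y → (adj G x y ≡ true ⇔ Alternate x y w))

  HasUniformRep : Graph V → ℕ → Set
  HasUniformRep G k = ∃[ w ] (Uniform k w × Represents G w)

  IsRepNumber : Graph V → ℕ → Set
  IsRepNumber G r = HasUniformRep G r × (∀ k → HasUniformRep G k → r ≤ k)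

biVertex-≟ : ∀ {m n} → DecidableEquality (BiVertex m n)
biVertex-≟ = Data.Sum.Properties.≡-dec Data.Fin._≟_ Data.Fin._≟_
  where import Data.Sum.Properties
        import Data.Fin

{-# OPTIONS --safe #-}
-- If m = 0, connectedness forces n = 1. For m ≥ 1 it suffices to find a (t+1)-uniform word when the first
-- part consists of t ≥ 1 pairs {a, a′} (with a dummy vertex if m is odd), since then t + 1 ≤ ⌈(m+n)/4⌉.
-- Sort the vertices of the second part into four classes by their neighbours in the pair: N
-- (neither), A (only a), AB (both), A′ (only a′). In the gadget  N a A a′ AB a A′ a′  a vertex b
-- splits the two occurrences of a (resp. a′) exactly when it is adjacent to a (resp. a′).
-- For t ≥ 2 concatenate the gadgets of all pairs, writing before, between and after them the word
-- a′a for every pair that has no gadget next to that place. Every b occurs once per gadget, so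
-- it alternates with a member of a pair everywhere except possibly at the gadget of that pair.
-- Finally list the second part in the reverse of its order in the first gadget, which destroys
-- all alternation inside the second part. For t = 1 the two members of the pair would
-- alternate, and  N a A AB a A′ a′ A′ʳ ABʳ a′ Aʳ Nʳ  is used instead (ʳ is reversal).
module Submission where

open import Defs hiding (sym)
open import Data.Nat using (ℕ; zero; suc; _≤_; _<_; _+_; _*_; _/_; z≤n; s≤s)
open import Data.Nat.Properties using (≤-refl; ≤-trans; ≤-reflexive; +-mono-≤; +-monoʳ-≤; +-monoˡ-≤; +-suc; suc-injective; m≤m+n; n≤1+n) renaming (_≟_ to _≟ⁿ_)
open import Data.Nat.DivMod using (/-monoˡ-≤; m*n/n≡m)
open import Data.Nat.Divisibility using (_∣_; divides)
open import Data.Nat.ListAction using (sum)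
open import Data.Nat.Solver using (module +-*-Solver)
open import Data.Bool using (Bool; true; false; _∧_; _∨_; if_then_else_)
open import Data.Bool.Properties using () renaming (_≟_ to _≟ᵇ_)
open import Data.Empty using (⊥)
open import Data.Fin using (Fin; zero; suc; inject≤; remQuot) renaming (_≟_ to _≟ᶠ_)
open import Data.Fin.Properties using (any?; inject≤-injective; combine-remQuot; 2↔Bool)
open import Data.List using (List; []; _∷_; _++_; [_]; length; filter; concatMap; reverse; allFin; map; tabulate)
open import Data.List.Properties using (filter-++; map-cong; filter-≐; filter-accept; filter-reject; concatMap-++; concatMap-cong; unfold-reverse; reverse-++; length-map; length-tabulate; length-++; ++-identityʳ)
open import Data.List.Membership.Propositional using (_∈_)
open import Data.List.Membership.Propositional.Properties using (∈-allFin; ∈-filter⁻; ∈-map⁺; ∈-++⁺ˡ; ∈-++⁺ʳ)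
open import Data.List.Relation.Unary.All as All using (All; []; _∷_)
open import Data.List.Relation.Unary.Any using (here; there)
open import Data.List.Relation.Unary.AllPairs using ([]; _∷_)
open import Data.List.Relation.Unary.Unique.Propositional using (Unique)
open import Data.List.Relation.Unary.Unique.Propositional.Properties using (allFin⁺)
open import Data.Product using (∃; ∃₂; ∃-syntax; _×_; _,_; proj₁; proj₂; map₂; uncurry)
open import Data.Product.Properties using () renaming (≡-dec to ×-≡-dec)
open import Data.Sum using (_⊎_; inj₁; inj₂; [_,_]′; swap)
open import Data.Sum.Properties using () renaming (≡-dec to ⊎-≡-dec; inj₁-injective to inj₁-inj; inj₂-injective to inj₂-inj)
open import Function using (_∘_; id; const)
open import Function.Bundles using (_⇔_; mk⇔; Equivalence; Inverse; Injection)
open import Function.Properties.Inverse using (↔⇒↣)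
open import Relation.Binary.Definitions using (DecidableEquality)
open import Relation.Binary.PropositionalEquality using (_≡_; _≢_; refl; sym; trans; cong; cong₂; subst; subst₂; ≢-sym; _≗_)
open import Relation.Nullary using (¬_; Dec; yes; no; does; contradiction)
open import Relation.Nullary.Decidable using (_⊎-dec_; _×-dec_; _→-dec_; ¬?; map′; decidable-stable)
open import Relation.Unary using (Decidable)

-- Filtering, concatenation and reversal of lists.

module _ {V : Set} {P : V → Set} (P? : Decidable P) where

  filter-concatMap : {A : Set} (f : A → List V) (l : List A)
    → filter P? (concatMap f l) ≡ concatMap (filter P? ∘ f) l
  filter-concatMap f []      = refl
  filter-concatMap f (a ∷ l) = trans (filter-++ P? (f a) (concatMap f l))
                                     (cong (filter P? (f a) ++_) (filter-concatMap f l))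

  filter-reverse : (l : List V) → filter P? (reverse l) ≡ reverse (filter P? l)
  filter-reverse []      = refl
  filter-reverse (v ∷ l) = trans (cong (filter P?) (unfold-reverse v l))
    (trans (filter-++ P? (reverse l) [ v ])
    (trans (cong (_++ filter P? [ v ]) (filter-reverse l)) (last-letter v)))
    where
    last-letter : ∀ v → reverse (filter P? l) ++ filter P? [ v ] ≡ reverse (filter P? (v ∷ l))
    last-letter v with does (P? v)
    ... | true  = sym (unfold-reverse v (filter P? l))
    ... | false = ++-identityʳ _

concatMap-[] : {A V : Set} (h : A → List V) (l : List A)
  → All (λ i → h i ≡ []) l → concatMap h l ≡ []
concatMap-[] h []      []       = refl
concatMap-[] h (i ∷ l) (e ∷ es) = cong₂ _++_ e (concatMap-[] h l es)

-- Evaluates restrictions of words listed over all vertices or all pairs: only one index survives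
-- the filter.
concatMap-single : {A V : Set} (h : A → List V) {q : A} {l : List A} → Unique l → q ∈ l
  → (∀ i → i ≢ q → h i ≡ []) → concatMap h l ≡ h q
concatMap-single h {q} {_ ∷ l} (q∉l ∷ _) (here refl) empty =
  trans (cong (h q ++_) (concatMap-[] h l (All.map (λ q≢i → empty _ (≢-sym q≢i)) q∉l)))
        (++-identityʳ (h q))
concatMap-single h {q} {i ∷ l} (i∉l ∷ u) (there q∈l) empty =
  cong₂ _++_ (empty i (All.lookup i∉l q∈l)) (concatMap-single h u q∈l empty)

reverse-concatMap : {A V : Set} (f : A → List V) (l : List A)
  → reverse (concatMap f l) ≡ concatMap (reverse ∘ f) (reverse l)
reverse-concatMap f []      = refl
reverse-concatMap f (a ∷ l) = trans (reverse-++ (f a) (concatMap f l))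
  (trans (cong₂ _++_ (reverse-concatMap f l) (sym (++-identityʳ (reverse (f a)))))
  (trans (sym (concatMap-++ (reverse ∘ f) (reverse l) [ a ]))
         (cong (concatMap (reverse ∘ f)) (sym (unfold-reverse a l)))))

-- Occurrences, restrictions and repetitions in words.

module _ {V : Set} (_≟_ : DecidableEquality V) where

  occurs⇒∈ : ∀ {x k} (w : List V) → occ _≟_ x w ≡ suc k → x ∈ w
  occurs⇒∈ {x} w e with filter (_≟ x) w in eq
  ... | v ∷ _ with ∈-filter⁻ (_≟ x) {xs = w} (subst (v ∈_) (sym eq) (here refl))
  ...            | v∈w , refl = v∈w

  restrict-sym : ∀ x y w → restrict _≟_ x y w ≡ restrict _≟_ y x w
  restrict-sym x y = filter-≐ _ _ (swap , swap)

  restrict-accept : ∀ x y w {v} → v ≡ x ⊎ v ≡ y → restrict _≟_ x y (v ∷ w) ≡ v ∷ restrict _≟_ x y w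
  restrict-accept x y w = filter-accept (λ z → (z ≟ x) ⊎-dec (z ≟ y))

  restrict-reject : ∀ x y w {v} → ¬ (v ≡ x ⊎ v ≡ y) → restrict _≟_ x y (v ∷ w) ≡ restrict _≟_ x y w
  restrict-reject x y w = filter-reject (λ z → (z ≟ x) ⊎-dec (z ≟ y))

  alternate-sym : ∀ {x y w} → Alternate _≟_ x y w → Alternate _≟_ y x w
  alternate-sym {x} {y} {w} = subst (NoRepeat _≟_) (restrict-sym x y w)

  occ-restrictˡ : ∀ x y w → occ _≟_ x (restrict _≟_ x y w) ≡ occ _≟_ x w
  occ-restrictˡ x y w = cong length (go w)
    where
    go : ∀ w → filter (_≟ x) (restrict _≟_ x y w) ≡ filter (_≟ x) w
    go []      = refl
    go (v ∷ w) with v ≟ x in eq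
    ... | yes _ rewrite eq = cong (v ∷_) (go w)
    ... | no _  with v ≟ y
    ...   | yes _ rewrite eq = go w
    ...   | no _  = go w

  occ-restrictʳ : ∀ x y w → occ _≟_ y (restrict _≟_ x y w) ≡ occ _≟_ y w
  occ-restrictʳ x y w = trans (cong (occ _≟_ y) (restrict-sym x y w)) (occ-restrictˡ y x w)

  occ-++ : ∀ x u v → occ _≟_ x (u ++ v) ≡ occ _≟_ x u + occ _≟_ x v
  occ-++ x u v = trans (cong length (filter-++ (_≟ x) u v)) (length-++ (filter (_≟ x) u))

  restrict-absentˡ : ∀ x y w → occ _≟_ x w ≡ 0 → restrict _≟_ x y w ≡ filter (_≟ y) w
  restrict-absentˡ x y []      e = refl
  restrict-absentˡ x y (v ∷ w) e with v ≟ x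
  ... | no _ with v ≟ y
  ...   | yes _ = cong (v ∷_) (restrict-absentˡ x y w e)
  ...   | no _  = restrict-absentˡ x y w e

  filter-≟-replicate : ∀ {x k} w → occ _≟_ x w ≡ k → filter (_≟ x) w ≡ Data.List.replicate k x
  filter-≟-replicate []      refl = refl
  filter-≟-replicate {x} (v ∷ w) e with v ≟ x
  filter-≟-replicate (v ∷ w) refl | yes refl = cong (v ∷_) (filter-≟-replicate w refl)
  filter-≟-replicate (v ∷ w) e    | no _     = filter-≟-replicate w e

  restrict-once : ∀ x y w → x ≢ y → occ _≟_ x w ≡ 1 → occ _≟_ y w ≡ 1
    → restrict _≟_ x y w ≡ x ∷ y ∷ [] ⊎ restrict _≟_ x y w ≡ y ∷ x ∷ []
  restrict-once x y (v ∷ w) x≢y ex ey with v ≟ x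
  restrict-once x y (v ∷ w) x≢y ex ey | yes refl with v ≟ y
  ... | yes v≡y = contradiction v≡y x≢y
  ... | no _    = inj₁ (cong (v ∷_) (trans (restrict-absentˡ v y w (suc-injective ex)) (filter-≟-replicate w ey)))
  restrict-once x y (v ∷ w) x≢y ex ey | no _ with v ≟ y
  ... | yes refl = inj₂ (cong (v ∷_) (trans (restrict-sym x v w) (trans (restrict-absentˡ v x w (suc-injective ey)) (filter-≟-replicate w ex))))
  ... | no _     = restrict-once x y w x≢y ex ey

  NoRepeat-tail : ∀ {v w} → NoRepeat _≟_ (v ∷ w) → NoRepeat _≟_ w
  NoRepeat-tail (one _)    = nil
  NoRepeat-tail (cons _ r) = r

  NoRepeat-++ʳ : ∀ u {w} → NoRepeat _≟_ (u ++ w) → NoRepeat _≟_ w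
  NoRepeat-++ʳ []      r = r
  NoRepeat-++ʳ (v ∷ u) r = NoRepeat-++ʳ u (NoRepeat-tail r)

  -- Every failure of alternation below is shown by two equal neighbouring letters in a restriction.
  repeat-absurd : ∀ u {x w} → ¬ NoRepeat _≟_ (u ++ x ∷ x ∷ w)
  repeat-absurd u r with NoRepeat-++ʳ u r
  ... | cons x≢x _ = x≢x refl

  alternating : V → V → ℕ → List V
  alternating x y zero    = []
  alternating x y (suc k) = x ∷ y ∷ alternating x y k

  -- The leading `y` is the last letter of the block just passed, which lets the induction compare
  -- it with the next `x`.
  NoRepeat-alternating : ∀ {x y} → x ≢ y → ∀ k → NoRepeat _≟_ (y ∷ alternating x y k)
  NoRepeat-alternating x≢y zero    = one _
  NoRepeat-alternating x≢y (suc k) = cons (≢-sym x≢y) (cons x≢y (NoRepeat-alternating x≢y k))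

  alternating-++ : ∀ x y i j → alternating x y i ++ alternating x y j ≡ alternating x y (i + j)
  alternating-++ x y zero    j = refl
  alternating-++ x y (suc i) j = cong (λ l → x ∷ y ∷ l) (alternating-++ x y i j)

  occ-hit : ∀ {x w k} → occ _≟_ x w ≡ k → occ _≟_ x (x ∷ w) ≡ suc k
  occ-hit {x} e = trans (cong length (filter-accept (_≟ x) refl)) (cong suc e)

  occ-miss : ∀ {x v w k} → v ≢ x → occ _≟_ x w ≡ k → occ _≟_ x (v ∷ w) ≡ k
  occ-miss {x} v≢x e = trans (cong length (filter-reject (_≟ x) v≢x)) e

  occ-alternatingˡ : ∀ {x y} → x ≢ y → ∀ k → occ _≟_ x (alternating x y k) ≡ k
  occ-alternatingˡ x≢y zero    = refl
  occ-alternatingˡ x≢y (suc k) = occ-hit (occ-miss (≢-sym x≢y) (occ-alternatingˡ x≢y k))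

  occ-alternatingʳ : ∀ {x y} → x ≢ y → ∀ k → occ _≟_ y (alternating x y k) ≡ k
  occ-alternatingʳ x≢y zero    = refl
  occ-alternatingʳ x≢y (suc k) = occ-miss x≢y (occ-hit (occ-alternatingʳ x≢y k))

-- Token lists and the two-letter patterns that they spell.

only : {V : Set} → Bool → V → List V
only b v = if b then [ v ] else []

-- A token describes a piece of a word attached to one pair of vertices of the first part:
-- a member of the pair, or the vertices of the second part with a prescribed adjacency to the
-- two members of the pair, listed forwards or backwards.
data Token : Set where
  slot         : Bool → Token
  class classʳ : Bool → Bool → Token

module _ {V : Set} where

  interpret : (Bool → List V) → (Bool → Bool → List V) → Token → List V
  interpret g h (slot c)     = g c
  interpret g h (class c d)  = h c d
  interpret g h (classʳ c d) = reverse (h c d)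

  spell : (Bool → List V) → (Bool → Bool → List V) → List Token → List V
  spell g h = concatMap (interpret g h)

  spell-cong : ∀ {g g′ h h′} → (∀ c → g c ≡ g′ c) → (∀ c d → h c d ≡ h′ c d)
    → spell g h ≗ spell g′ h′
  spell-cong {g} {g′} {h} {h′} eg eh = concatMap-cong eq
    where
    eq : interpret g h ≗ interpret g′ h′
    eq (slot c)     = eg c
    eq (class c d)  = eh c d
    eq (classʳ c d) = cong reverse (eh c d)

  spell-congˡ : ∀ h {g g′} → (∀ c → g c ≡ g′ c) → spell g h ≗ spell g′ h
  spell-congˡ h e = spell-cong e (λ c d → refl)

  spell-congʳ : ∀ g {h h′} → (∀ c d → h c d ≡ h′ c d) → spell g h ≗ spell g h′
  spell-congʳ g = spell-cong (λ c → refl)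

  -- Filtering commutes with concatenation and reversal, so a restricted piece is the same token
  -- list read with restricted letters. What remains is a finite computation over Booleans.
  filter-spell : ∀ {P : V → Set} (P? : Decidable P) g h ts
    → filter P? (spell g h ts) ≡ spell (filter P? ∘ g) (λ c d → filter P? (h c d)) ts
  filter-spell P? g h ts = trans (filter-concatMap P? (interpret g h) ts) (concatMap-cong eq ts)
    where
    eq : filter P? ∘ interpret g h ≗ interpret (filter P? ∘ g) (λ c d → filter P? (h c d))
    eq (slot c)     = refl
    eq (class c d)  = refl
    eq (classʳ c d) = filter-reverse P? (h c d)

-- `slot false` is a, `slot true` is a′, and `class c d` records adjacency to a by `c` and to a′ by
-- `d`. With the slots erased, `gadget` becomes `classes` and `solo` becomes `classes ++ classesʳ`;
-- this governs the order on the second part.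
classes classesʳ gadget solo : List Token
classes  = class false false ∷ class true false ∷ class true true ∷ class false true ∷ []
classesʳ = classʳ false true ∷ classʳ true true ∷ classʳ true false ∷ classʳ false false ∷ []
gadget   = class false false ∷ slot false ∷ class true false ∷ slot true
         ∷ class true true ∷ slot false ∷ class false true ∷ slot true ∷ []
solo     = class false false ∷ slot false ∷ class true false ∷ class true true ∷ slot false ∷ class false true
         ∷ slot true ∷ classʳ false true ∷ classʳ true true ∷ slot true ∷ classʳ true false ∷ classʳ false false ∷ []

match : Bool → Bool → Bool → Bool → Bool
match m₀ m₁ c d = does (m₀ ≟ᵇ c) ∧ does (m₁ ≟ᵇ d)

choose : Bool → Bool → Bool → Bool
choose c m₀ m₁ = if c then m₁ else m₀

module _ {V : Set} where

  -- `at c₀ x` and `typed m₀ m₁ y` are what restriction to one member `x` of a pair and one vertex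
  -- `y` of the second part leaves of slots and classes. The patterns then follow by evaluating each
  -- Boolean case.
  at : Bool → V → Bool → List V
  at c₀ x c = only (does (c ≟ᵇ c₀)) x

  typed : Bool → Bool → V → Bool → Bool → List V
  typed m₀ m₁ y c d = only (match m₀ m₁ c d) y

  spell-slots : ∀ c₀ x h → spell (at c₀ x) h (slot true ∷ slot false ∷ []) ≡ [ x ]
  spell-slots true  x h = refl
  spell-slots false x h = refl

  spell-gadget-slots : ∀ c₀ x → spell (at c₀ x) (λ _ _ → []) gadget ≡ x ∷ x ∷ []
  spell-gadget-slots true  x = refl
  spell-gadget-slots false x = refl

  spell-gadget-other : ∀ m₀ m₁ y → spell (const []) (typed m₀ m₁ y) gadget ≡ [ y ]
  spell-gadget-other true  true  y = refl
  spell-gadget-other true  false y = refl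
  spell-gadget-other false true  y = refl
  spell-gadget-other false false y = refl

  spell-classes : ∀ m₀ m₁ y g → spell g (typed m₀ m₁ y) classes ≡ [ y ]
  spell-classes true  true  y g = refl
  spell-classes true  false y g = refl
  spell-classes false true  y g = refl
  spell-classes false false y g = refl

  spell-classesʳ : ∀ m₀ m₁ y g → spell g (typed m₀ m₁ y) classesʳ ≡ [ y ]
  spell-classesʳ true  true  y g = refl
  spell-classesʳ true  false y g = refl
  spell-classesʳ false true  y g = refl
  spell-classesʳ false false y g = refl

  -- The possible traces of a gadget on a member `x` of its pair and a vertex `y`. The Boolean is
  -- their adjacency, and it is `false` exactly when the two `x` are neighbours.
  data Pattern (x y : V) : Bool → List V → Set where
    xyx : Pattern x y true  (x ∷ y ∷ x ∷ [])
    yxx : Pattern x y false (y ∷ x ∷ x ∷ [])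
    xxy : Pattern x y false (x ∷ x ∷ y ∷ [])

  spell-gadget : ∀ c₀ m₀ m₁ x y → Pattern x y (choose c₀ m₀ m₁) (spell (at c₀ x) (typed m₀ m₁ y) gadget)
  spell-gadget true  true  true  x y = xyx
  spell-gadget true  true  false x y = yxx
  spell-gadget true  false true  x y = xyx
  spell-gadget true  false false x y = yxx
  spell-gadget false true  true  x y = xyx
  spell-gadget false true  false x y = xyx
  spell-gadget false false true  x y = xxy
  spell-gadget false false false x y = yxx

  -- Traces of the whole word for a single pair, so that these patterns alone decide alternation.
  data Pattern₂ (x y : V) : Bool → List V → Set where
    xyxy : Pattern₂ x y true  (x ∷ y ∷ x ∷ y ∷ [])
    yxyx : Pattern₂ x y true  (y ∷ x ∷ y ∷ x ∷ [])
    yxxy : Pattern₂ x y false (y ∷ x ∷ x ∷ y ∷ [])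
    xxyy : Pattern₂ x y false (x ∷ x ∷ y ∷ y ∷ [])

  spell-solo : ∀ c₀ m₀ m₁ x y → Pattern₂ x y (choose c₀ m₀ m₁) (spell (at c₀ x) (typed m₀ m₁ y) solo)
  spell-solo true  true  true  x y = yxyx
  spell-solo true  true  false x y = yxxy
  spell-solo true  false true  x y = yxyx
  spell-solo true  false false x y = yxxy
  spell-solo false true  true  x y = xyxy
  spell-solo false true  false x y = xyxy
  spell-solo false false true  x y = xxyy
  spell-solo false false false x y = yxxy

  module _ (_≟_ : DecidableEquality V) {x y : V} (x≢y : x ≢ y) where

    Pattern₂-occˡ : ∀ {b l} → Pattern₂ x y b l → occ _≟_ x l ≡ 2
    Pattern₂-occˡ xyxy = occ-hit _≟_ (occ-miss _≟_ (≢-sym x≢y) (occ-hit _≟_ (occ-miss _≟_ (≢-sym x≢y) refl)))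
    Pattern₂-occˡ yxyx = occ-miss _≟_ (≢-sym x≢y) (occ-hit _≟_ (occ-miss _≟_ (≢-sym x≢y) (occ-hit _≟_ refl)))
    Pattern₂-occˡ yxxy = occ-miss _≟_ (≢-sym x≢y) (occ-hit _≟_ (occ-hit _≟_ (occ-miss _≟_ (≢-sym x≢y) refl)))
    Pattern₂-occˡ xxyy = occ-hit _≟_ (occ-hit _≟_ (occ-miss _≟_ (≢-sym x≢y) (occ-miss _≟_ (≢-sym x≢y) refl)))

    Pattern₂-occʳ : ∀ {b l} → Pattern₂ x y b l → occ _≟_ y l ≡ 2
    Pattern₂-occʳ xyxy = occ-miss _≟_ x≢y (occ-hit _≟_ (occ-miss _≟_ x≢y (occ-hit _≟_ refl)))
    Pattern₂-occʳ yxyx = occ-hit _≟_ (occ-miss _≟_ x≢y (occ-hit _≟_ (occ-miss _≟_ x≢y refl)))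
    Pattern₂-occʳ yxxy = occ-hit _≟_ (occ-miss _≟_ x≢y (occ-miss _≟_ x≢y (occ-hit _≟_ refl)))
    Pattern₂-occʳ xxyy = occ-miss _≟_ x≢y (occ-miss _≟_ x≢y (occ-hit _≟_ (occ-hit _≟_ refl)))

    Pattern₂-alternate : ∀ {b l} → Pattern₂ x y b l → b ≡ true ⇔ NoRepeat _≟_ l
    Pattern₂-alternate xyxy = mk⇔ (λ _ → cons x≢y (cons (≢-sym x≢y) (cons x≢y (one y)))) (λ _ → refl)
    Pattern₂-alternate yxyx = mk⇔ (λ _ → cons (≢-sym x≢y) (cons x≢y (cons (≢-sym x≢y) (one x)))) (λ _ → refl)
    Pattern₂-alternate yxxy = mk⇔ (λ ()) (λ r → contradiction r (repeat-absurd _≟_ [ y ]))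
    Pattern₂-alternate xxyy = mk⇔ (λ ()) (λ r → contradiction r (repeat-absurd _≟_ []))

-- Building blocks over a fixed adjacency matrix with a paired first part.

module Construction {t n : ℕ} (M : Fin t × Bool → Fin n → Bool) where

  V : Set
  V = (Fin t × Bool) ⊎ Fin n

  abstract
    _≟_ : DecidableEquality V
    _≟_ = ⊎-≡-dec (×-≡-dec _≟ᶠ_ _≟ᵇ_) _≟ᶠ_

  member : Fin t → Bool → List V
  member p c = [ inj₁ (p , c) ]

  hasType : Fin t → Bool → Bool → Fin n → Bool
  hasType p c d q = match (M (p , false) q) (M (p , true) q) c d

  neighbours : Fin t → Bool → Bool → List V
  neighbours p c d = concatMap (λ q → only (hasType p c d q) (inj₂ q)) (allFin n)

  pieces : Fin t → List Token → List V
  pieces p = spell (member p) (neighbours p)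

  -- The order a′a is opposite to that of the gadget: beside a a′ a a′ it produces a repeated
  -- letter, so the members of a pair cannot alternate.
  pair : Fin t → List V
  pair p = inj₁ (p , true) ∷ inj₁ (p , false) ∷ []

  pair-unless : Bool → Fin t → List V
  pair-unless b p = if b then [] else pair p

  -- The stretch between the gadgets of `p` and `p′`. Equal arguments serve at both ends of the
  -- word, where only one gadget is adjacent.
  others : Fin t → Fin t → List V
  others p p′ = concatMap (λ r → pair-unless (does (r ≟ᶠ p) ∨ does (r ≟ᶠ p′)) r) (allFin t)

  module _ {P : V → Set} (P? : Decidable P) where

    filter-only-accept : ∀ b {v} → P v → filter P? (only b v) ≡ only b v
    filter-only-accept true  Pv = filter-accept P? Pv
    filter-only-accept false Pv = refl

    filter-only-reject : ∀ b {v} → ¬ P v → filter P? (only b v) ≡ []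
    filter-only-reject true  ¬Pv = filter-reject P? ¬Pv
    filter-only-reject false ¬Pv = refl

    filter-neighbours : ∀ {q} → P (inj₂ q) → (∀ q′ → q′ ≢ q → ¬ P (inj₂ q′)) → ∀ p c d
      → filter P? (neighbours p c d) ≡ only (hasType p c d q) (inj₂ q)
    filter-neighbours {q} Pq ¬P p c d =
      trans (filter-concatMap P? _ (allFin n))
      (trans (concatMap-single _ (allFin⁺ n) (∈-allFin q) (λ i i≢q → filter-only-reject (hasType p c d i) (¬P i i≢q)))
             (filter-only-accept (hasType p c d q) Pq))

    filter-neighbours-none : (∀ q → ¬ P (inj₂ q)) → ∀ p c d → filter P? (neighbours p c d) ≡ []
    filter-neighbours-none ¬P p c d =
      trans (filter-concatMap P? _ (allFin n))
            (concatMap-[] _ (allFin n) (All.universal (λ q → filter-only-reject (hasType p c d q) (¬P q)) (allFin n)))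

    filter-pair-none : ∀ b {p} → (∀ c → ¬ P (inj₁ (p , c))) → filter P? (pair-unless b p) ≡ []
    filter-pair-none true  ¬P = refl
    filter-pair-none false ¬P = trans (filter-reject P? (¬P true)) (filter-reject P? (¬P false))

    filter-others-none : (∀ p c → ¬ P (inj₁ (p , c))) → ∀ p p′ → filter P? (others p p′) ≡ []
    filter-others-none ¬P p p′ =
      trans (filter-concatMap P? _ (allFin t))
            (concatMap-[] _ (allFin t) (All.universal (λ r → filter-pair-none (does (r ≟ᶠ p) ∨ does (r ≟ᶠ p′)) (¬P r)) (allFin t)))

    filter-others : ∀ {r} → (∀ r′ c → r′ ≢ r → ¬ P (inj₁ (r′ , c))) → ∀ p p′
      → filter P? (others p p′) ≡ filter P? (pair-unless (does (r ≟ᶠ p) ∨ does (r ≟ᶠ p′)) r)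
    filter-others {r} ¬P p p′ =
      trans (filter-concatMap P? _ (allFin t))
            (concatMap-single _ (allFin⁺ t) (∈-allFin r)
              (λ i i≢r → filter-pair-none (does (i ≟ᶠ p) ∨ does (i ≟ᶠ p′)) (λ c → ¬P i c i≢r)))

    filter-others-out : ∀ {r} → (∀ r′ c → r′ ≢ r → ¬ P (inj₁ (r′ , c))) → ∀ {p p′} → r ≢ p → r ≢ p′
      → filter P? (others p p′) ≡ filter P? (pair r)
    filter-others-out {r} ¬P {p} {p′} r≢p r≢p′ with filter-others ¬P p p′
    ... | e with r ≟ᶠ p | r ≟ᶠ p′
    ...   | yes r≡p | _        = contradiction r≡p r≢p
    ...   | no _    | yes r≡p′ = contradiction r≡p′ r≢p′
    ...   | no _    | no _     = e

    filter-others-in : ∀ {r} → (∀ r′ c → r′ ≢ r → ¬ P (inj₁ (r′ , c))) → ∀ {p p′} → r ≡ p ⊎ r ≡ p′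
      → filter P? (others p p′) ≡ []
    filter-others-in {r} ¬P {p} {p′} r≡ with filter-others ¬P p p′
    ... | e with r ≟ᶠ p | r ≟ᶠ p′
    ...   | yes _   | _       = e
    ...   | no _    | yes _   = e
    ...   | no r≢p  | no r≢p′ = contradiction r≡ [ r≢p , r≢p′ ]′

  -- Restrictions of the building blocks to two letters.

  module Cross (p₀ : Fin t) (c₀ : Bool) (q : Fin n) where

    x y : V
    x = inj₁ (p₀ , c₀)
    y = inj₂ q

    x≢y : x ≢ y
    x≢y ()

    R : List V → List V
    R = restrict _≟_ x y

    R-neighbours : ∀ p c d → R (neighbours p c d) ≡ only (hasType p c d q) y
    R-neighbours = filter-neighbours _ (inj₂ refl) λ { q′ q′≢q (inj₂ e) → q′≢q (inj₂-inj e) }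

    other-pair : ∀ r c → r ≢ p₀ → ¬ (inj₁ (r , c) ≡ x ⊎ inj₁ (r , c) ≡ y)
    other-pair r c r≢ (inj₁ refl) = r≢ refl

    R-member : ∀ c → R (member p₀ c) ≡ only (does (c ≟ᵇ c₀)) x
    R-member c with c ≟ᵇ c₀
    ... | yes refl = restrict-accept _≟_ x y [] (inj₁ refl)
    ... | no c≢c₀  = restrict-reject _≟_ x y [] λ { (inj₁ refl) → c≢c₀ refl }

    R-pieces : ∀ ts → R (pieces p₀ ts)
      ≡ spell (at c₀ x) (typed (M (p₀ , false) q) (M (p₀ , true) q) y) ts
    R-pieces ts = trans (filter-spell _ (member p₀) (neighbours p₀) ts)
                        (spell-cong R-member (R-neighbours p₀) ts)

    R-pieces-other : ∀ {p} → p ≢ p₀ → ∀ ts → R (pieces p ts)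
      ≡ spell (const []) (typed (M (p , false) q) (M (p , true) q) y) ts
    R-pieces-other {p} p≢p₀ ts = trans (filter-spell _ (member p) (neighbours p) ts)
      (spell-cong (λ c → restrict-reject _≟_ x y [] (other-pair p c p≢p₀)) (R-neighbours p) ts)

    R-pair : R (pair p₀) ≡ [ x ]
    R-pair = trans (R-pieces (slot true ∷ slot false ∷ [])) (spell-slots c₀ x (typed (M (p₀ , false) q) (M (p₀ , true) q) y))

    R-others-out : ∀ {p p′} → p₀ ≢ p → p₀ ≢ p′ → R (others p p′) ≡ [ x ]
    R-others-out p₀≢p p₀≢p′ = trans (filter-others-out _ other-pair p₀≢p p₀≢p′) R-pair

    R-others-in : ∀ {p p′} → p₀ ≡ p ⊎ p₀ ≡ p′ → R (others p p′) ≡ []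
    R-others-in = filter-others-in _ other-pair

    R-gadget-other : ∀ {p} → p₀ ≢ p → R (pieces p gadget) ≡ [ y ]
    R-gadget-other {p} p₀≢p = trans (R-pieces-other (≢-sym p₀≢p) gadget)
                                    (spell-gadget-other (M (p , false) q) (M (p , true) q) y)

    R-classesʳ : ∀ p → R (pieces p classesʳ) ≡ [ y ]
    R-classesʳ p = trans (filter-spell _ (member p) (neighbours p) classesʳ)
      (trans (spell-congʳ (R ∘ member p) (R-neighbours p) classesʳ)
             (spell-classesʳ (M (p , false) q) (M (p , true) q) y (R ∘ member p)))

    M-choose : M (p₀ , c₀) q ≡ choose c₀ (M (p₀ , false) q) (M (p₀ , true) q)
    M-choose = lemma c₀
      where
      lemma : ∀ c → M (p₀ , c) q ≡ choose c (M (p₀ , false) q) (M (p₀ , true) q)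
      lemma true  = refl
      lemma false = refl

  module Second (q q′ : Fin n) (q≢q′ : q ≢ q′) where

    x y : V
    x = inj₂ q
    y = inj₂ q′

    x≢y : x ≢ y
    x≢y e = q≢q′ (inj₂-inj e)

    R : List V → List V
    R = restrict _≟_ x y

    R-member : ∀ p c → R (member p c) ≡ []
    R-member p c = restrict-reject _≟_ x y [] λ { (inj₁ ()) ; (inj₂ ()) }

    R-others : ∀ p p′ → R (others p p′) ≡ []
    R-others = filter-others-none _ λ { p c (inj₁ ()) ; p c (inj₂ ()) }

    R-pieces : ∀ p ts → R (pieces p ts) ≡ spell (const []) (λ c d → R (neighbours p c d)) ts
    R-pieces p ts = trans (filter-spell _ (member p) (neighbours p) ts)
                          (spell-congˡ _ (R-member p) ts)

    -- Slots vanish when only letters of the second part are kept, and both sides then reduce to the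
    -- same word.
    R-gadget : ∀ p → R (pieces p gadget) ≡ R (pieces p classes)
    R-gadget p = trans (R-pieces p gadget) (sym (R-pieces p classes))

    R-classesʳ : ∀ p → R (pieces p classesʳ) ≡ reverse (R (pieces p classes))
    R-classesʳ p = trans (R-pieces p classesʳ)
      (trans (sym (reverse-concatMap (interpret (const []) λ c d → R (neighbours p c d)) classes))
             (cong reverse (sym (R-pieces p classes))))

    occ-classes : ∀ p q → occ _≟_ (inj₂ q) (pieces p classes) ≡ 1
    occ-classes p q = cong length (trans (filter-spell (_≟ inj₂ q) (member p) (neighbours p) classes)
      (trans (spell-congʳ (filter (_≟ inj₂ q) ∘ member p) (filter-neighbours (_≟ inj₂ q) refl (λ { _ q′≢q refl → q′≢q refl }) p) classes)
             (spell-classes (M (p , false) q) (M (p , true) q) (inj₂ q) (filter (_≟ inj₂ q) ∘ member p))))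

    R-classes : ∀ p → R (pieces p classes) ≡ x ∷ y ∷ [] ⊎ R (pieces p classes) ≡ y ∷ x ∷ []
    R-classes p = restrict-once _≟_ x y (pieces p classes) x≢y (occ-classes p q) (occ-classes p q′)

  module First (p₀ : Fin t) (c₀ : Bool) (s : Fin t × Bool) where

    x y : V
    x = inj₁ (p₀ , c₀)
    y = inj₁ s

    R : List V → List V
    R = restrict _≟_ x y

    R-pieces : ∀ p ts → R (pieces p ts) ≡ spell (R ∘ member p) (λ _ _ → []) ts
    R-pieces p ts = trans (filter-spell _ (member p) (neighbours p) ts)
      (spell-congʳ (R ∘ member p) (filter-neighbours-none _ (λ { _ (inj₁ ()) ; _ (inj₂ ()) }) p) ts)

    R-member : proj₁ s ≢ p₀ → ∀ c → R (member p₀ c) ≡ only (does (c ≟ᵇ c₀)) x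
    R-member p≢p₀ c with c ≟ᵇ c₀
    ... | yes refl = restrict-accept _≟_ x y [] (inj₁ refl)
    ... | no c≢c₀  = restrict-reject _≟_ x y [] λ { (inj₁ refl) → c≢c₀ refl ; (inj₂ refl) → p≢p₀ refl }

    -- `y` belongs to another pair, so nothing separates the two copies of `x`; this is why members
    -- of different pairs never alternate.
    R-gadget : proj₁ s ≢ p₀ → R (pieces p₀ gadget) ≡ x ∷ x ∷ []
    R-gadget p≢p₀ = trans (R-pieces p₀ gadget)
      (trans (spell-congˡ (λ _ _ → []) (R-member p≢p₀) gadget) (spell-gadget-slots c₀ x))

  module SamePair (p₀ : Fin t) where

    open First p₀ false (p₀ , true) public hiding (R-pieces; R-member; R-gadget)

    R-member : ∀ c → R (member p₀ c) ≡ member p₀ c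
    R-member false = restrict-accept _≟_ x y [] (inj₁ refl)
    R-member true  = restrict-accept _≟_ x y [] (inj₂ refl)

    other-pair : ∀ r c → r ≢ p₀ → ¬ (inj₁ (r , c) ≡ x ⊎ inj₁ (r , c) ≡ y)
    other-pair r c r≢ (inj₁ refl) = r≢ refl
    other-pair r c r≢ (inj₂ refl) = r≢ refl

    R-pieces : ∀ ts → R (pieces p₀ ts) ≡ spell (member p₀) (λ _ _ → []) ts
    R-pieces ts = trans (First.R-pieces p₀ false (p₀ , true) p₀ ts) (spell-congˡ (λ _ _ → []) R-member ts)

    R-gadget : R (pieces p₀ gadget) ≡ x ∷ y ∷ x ∷ y ∷ []
    R-gadget = R-pieces gadget

    R-gadget-other : ∀ {p} → p₀ ≢ p → R (pieces p gadget) ≡ []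
    R-gadget-other {p} p₀≢p = trans (First.R-pieces p₀ false (p₀ , true) p gadget)
      (spell-congˡ (λ _ _ → []) {g′ = const []} (λ c → restrict-reject _≟_ x y [] (other-pair p c (≢-sym p₀≢p))) gadget)

    R-others-out : ∀ {p p′} → p₀ ≢ p → p₀ ≢ p′ → R (others p p′) ≡ y ∷ x ∷ []
    R-others-out p₀≢p p₀≢p′ = trans (filter-others-out _ other-pair p₀≢p p₀≢p′) (R-pieces (slot true ∷ slot false ∷ []))

    R-others-in : ∀ {p p′} → p₀ ≡ p ⊎ p₀ ≡ p′ → R (others p p′) ≡ []
    R-others-in = filter-others-in _ other-pair

  -- Representation split according to the parts of the two letters. That every vertex occurs is
  -- recovered later from uniformity with positive `k`.
  record Good (k : ℕ) (w : List V) : Set where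
    field
      uniform : Uniform _≟_ k w
      cross   : ∀ s q → M s q ≡ true ⇔ Alternate _≟_ (inj₁ s) (inj₂ q) w
      first   : ∀ s s′ → s ≢ s′ → ¬ Alternate _≟_ (inj₁ s) (inj₁ s′) w
      second  : ∀ q q′ → q ≢ q′ → ¬ Alternate _≟_ (inj₂ q) (inj₂ q′) w

  -- The chain of gadgets for two or more pairs.

  module Chain (p₁ : Fin t) where

    -- The first argument is the pair whose gadget comes just before. The whole word is
    -- `chain p₁ (p₁ ∷ ps)`: naming `p₁` as its own predecessor makes the opening stretch omit `p₁`
    -- only. The closing reversal undoes the order of the first gadget, hence the fixed `p₁`.
    chain : Fin t → List (Fin t) → List V
    chain p []        = others p p ++ pieces p₁ classesʳ
    chain p (p′ ∷ ps) = others p p′ ++ pieces p′ gadget ++ chain p′ ps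

    restrict-chain : ∀ {x y o g r} p p′ ps → restrict _≟_ x y (others p p′) ≡ o
      → restrict _≟_ x y (pieces p′ gadget) ≡ g → restrict _≟_ x y (chain p′ ps) ≡ r
      → restrict _≟_ x y (chain p (p′ ∷ ps)) ≡ o ++ g ++ r
    restrict-chain {x} {y} p p′ ps eo eg er =
      trans (filter-++ (λ z → (z ≟ x) ⊎-dec (z ≟ y)) (others p p′) (pieces p′ gadget ++ chain p′ ps))
            (cong₂ _++_ eo (trans (filter-++ _ (pieces p′ gadget) (chain p′ ps)) (cong₂ _++_ eg er)))

    restrict-chain-[] : ∀ {x y o r} p → restrict _≟_ x y (others p p) ≡ o
      → restrict _≟_ x y (pieces p₁ classesʳ) ≡ r → restrict _≟_ x y (chain p []) ≡ o ++ r
    restrict-chain-[] p eo er = trans (filter-++ _ (others p p) (pieces p₁ classesʳ)) (cong₂ _++_ eo er)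

    module _ (p₀ : Fin t) (c₀ : Bool) (q : Fin n) where

      open Cross p₀ c₀ q

      G : List V
      G = R (pieces p₀ gadget)

      -- Away from the gadget of `p₀`, each stretch contributes `x` and each gadget, as well as the
      -- closing reversal, contributes `y`.
      chain-avoiding : ∀ p ps → p₀ ≢ p → All (p₀ ≢_) ps
        → R (chain p ps) ≡ alternating _≟_ x y (suc (length ps))
      chain-avoiding p []        p₀≢p []             = restrict-chain-[] p (R-others-out p₀≢p p₀≢p) (R-classesʳ p₁)
      chain-avoiding p (p′ ∷ ps) p₀≢p (p₀≢p′ ∷ p₀∉) =
        restrict-chain p p′ ps (R-others-out p₀≢p p₀≢p′) (R-gadget-other p₀≢p′) (chain-avoiding p′ ps p₀≢p′ p₀∉)

      chain-from : ∀ ps → All (p₀ ≢_) ps → R (chain p₀ ps) ≡ y ∷ alternating _≟_ x y (length ps)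
      chain-from []        []             = restrict-chain-[] p₀ (R-others-in (inj₁ refl)) (R-classesʳ p₁)
      chain-from (p′ ∷ ps) (p₀≢p′ ∷ p₀∉) =
        restrict-chain p₀ p′ ps (R-others-in (inj₁ refl)) (R-gadget-other p₀≢p′) (chain-avoiding p′ ps p₀≢p′ p₀∉)

      -- Here `i` gadgets precede that of `p₀` and `j` follow it. Both stretches next to `G` omit
      -- `p₀`; the single `y` after `G` comes from the next gadget or from the closing reversal.
      Split : ℕ → List V → Set
      Split k w = ∃₂ λ i j → suc (i + j) ≡ k
                × R w ≡ alternating _≟_ x y i ++ G ++ y ∷ alternating _≟_ x y j

      chain-through : ∀ p ps → p₀ ≢ p → Unique ps → p₀ ∈ ps → Split (length ps) (chain p ps)
      chain-through p (.p₀ ∷ ps) p₀≢p (p₀∉ ∷ _) (here refl) =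
        0 , length ps , refl , restrict-chain p p₀ ps (R-others-in (inj₂ refl)) refl (chain-from ps p₀∉)
      chain-through p (p′ ∷ ps) p₀≢p (p′∉ ∷ u) (there p₀∈ps)
        with p₀≢p′ ← ≢-sym (All.lookup p′∉ p₀∈ps)
        with i , j , e , r ← chain-through p′ ps p₀≢p′ u p₀∈ps =
        suc i , j , cong suc e , restrict-chain p p′ ps (R-others-out p₀≢p p₀≢p′) (R-gadget-other p₀≢p′) r

      -- `chain-through` assumes that `p₀` is not the preceding pair. At the start the nominal
      -- predecessor is `p₁` itself, so `p₀ = p₁` is a case of its own.
      chain-split : ∀ ps → Unique (p₁ ∷ ps) → p₀ ∈ p₁ ∷ ps → Split (suc (length ps)) (chain p₁ (p₁ ∷ ps))
      chain-split ps (p₁∉ ∷ u) (here refl) =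
        0 , length ps , refl , restrict-chain p₁ p₁ ps (R-others-in (inj₁ refl)) refl (chain-from ps p₁∉)
      chain-split ps (p₁∉ ∷ u) (there p₀∈ps)
        with p₀≢p₁ ← ≢-sym (All.lookup p₁∉ p₀∈ps)
        with i , j , e , r ← chain-through p₁ ps p₀≢p₁ u p₀∈ps =
        suc i , j , cong suc e , restrict-chain p₁ p₁ ps (R-others-out p₀≢p₁ p₀≢p₁) (R-gadget-other p₀≢p₁) r

      G-pattern : Pattern x y (M (p₀ , c₀) q) G
      G-pattern = subst₂ (Pattern x y) (sym M-choose) (sym (R-pieces gadget))
                         (spell-gadget c₀ (M (p₀ , false) q) (M (p₀ , true) q) x y)

      y≢x : y ≢ x
      y≢x = ≢-sym x≢y

      pattern-occˡ : ∀ {b g} → Pattern x y b g → ∀ j → occ _≟_ x (g ++ y ∷ alternating _≟_ x y j) ≡ 2 + j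
      pattern-occˡ xyx j = occ-hit _≟_ (occ-miss _≟_ y≢x (occ-hit _≟_ (occ-miss _≟_ y≢x (occ-alternatingˡ _≟_ x≢y j))))
      pattern-occˡ yxx j = occ-miss _≟_ y≢x (occ-hit _≟_ (occ-hit _≟_ (occ-miss _≟_ y≢x (occ-alternatingˡ _≟_ x≢y j))))
      pattern-occˡ xxy j = occ-hit _≟_ (occ-hit _≟_ (occ-miss _≟_ y≢x (occ-miss _≟_ y≢x (occ-alternatingˡ _≟_ x≢y j))))

      pattern-occʳ : ∀ {b g} → Pattern x y b g → ∀ j → occ _≟_ y (g ++ y ∷ alternating _≟_ x y j) ≡ 2 + j
      pattern-occʳ xyx j = occ-miss _≟_ x≢y (occ-hit _≟_ (occ-miss _≟_ x≢y (occ-hit _≟_ (occ-alternatingʳ _≟_ x≢y j))))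
      pattern-occʳ yxx j = occ-hit _≟_ (occ-miss _≟_ x≢y (occ-miss _≟_ x≢y (occ-hit _≟_ (occ-alternatingʳ _≟_ x≢y j))))
      pattern-occʳ xxy j = occ-miss _≟_ x≢y (occ-miss _≟_ x≢y (occ-hit _≟_ (occ-hit _≟_ (occ-alternatingʳ _≟_ x≢y j))))

      -- Each letter occurs `i` times before `G` and `2 + j` times from `G` on: `x` twice inside
      -- `G`, `y` once inside and once right after it.
      split-count : ∀ {i j k} → suc (i + j) ≡ k → i + (2 + j) ≡ suc k
      split-count {i} {j} refl = trans (+-suc i (suc j)) (cong suc (+-suc i j))

      split-occˡ : ∀ {k} w → Split k w → occ _≟_ x w ≡ suc k
      split-occˡ w (i , j , e , r) = trans (sym (occ-restrictˡ _≟_ x y w)) (trans (cong (occ _≟_ x) r)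
        (trans (occ-++ _≟_ x (alternating _≟_ x y i) _)
        (trans (cong₂ _+_ (occ-alternatingˡ _≟_ x≢y i) (pattern-occˡ G-pattern j)) (split-count {i} e))))

      split-occʳ : ∀ {k} w → Split k w → occ _≟_ y w ≡ suc k
      split-occʳ w (i , j , e , r) = trans (sym (occ-restrictʳ _≟_ x y w)) (trans (cong (occ _≟_ y) r)
        (trans (occ-++ _≟_ y (alternating _≟_ x y i) _)
        (trans (cong₂ _+_ (occ-alternatingʳ _≟_ x≢y i) (pattern-occʳ G-pattern j)) (split-count {i} e))))

      pattern⇒alternate : ∀ {g} i j → Pattern x y true g
        → NoRepeat _≟_ (alternating _≟_ x y i ++ g ++ y ∷ alternating _≟_ x y j)
      -- The trace xyx followed by `y` is two further blocks xy, so the whole restriction is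
      -- `alternating` with `i + (2 + j)` blocks.
      pattern⇒alternate i j xyx = subst (NoRepeat _≟_) (sym (alternating-++ _≟_ x y i (2 + j)))
        (NoRepeat-tail _≟_ (NoRepeat-alternating _≟_ x≢y (i + (2 + j))))

      alternate⇒pattern : ∀ {b g} i j → Pattern x y b g
        → NoRepeat _≟_ (alternating _≟_ x y i ++ g ++ y ∷ alternating _≟_ x y j) → b ≡ true
      alternate⇒pattern i j xyx r = refl
      alternate⇒pattern i j yxx r = contradiction (NoRepeat-++ʳ _≟_ (alternating _≟_ x y i) r) (repeat-absurd _≟_ [ y ])
      alternate⇒pattern i j xxy r = contradiction r (repeat-absurd _≟_ (alternating _≟_ x y i))

      split-cross : ∀ {k} w → Split k w → M (p₀ , c₀) q ≡ true ⇔ Alternate _≟_ x y w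
      split-cross w (i , j , _ , r) = mk⇔
        (λ e → subst (NoRepeat _≟_) (sym r) (pattern⇒alternate i j (subst (λ b → Pattern x y b G) e G-pattern)))
        (λ a → alternate⇒pattern i j G-pattern (subst (NoRepeat _≟_) r a))

    module _ (p₀ : Fin t) (c₀ : Bool) (s : Fin t × Bool) (p≢p₀ : proj₁ s ≢ p₀) where

      open First p₀ c₀ s

      chain-repeat : ∀ p ps → p₀ ∈ ps → ¬ NoRepeat _≟_ (R (chain p ps))
      chain-repeat p (.p₀ ∷ ps) (here refl) r =
        repeat-absurd _≟_ (R (others p p₀)) (subst (NoRepeat _≟_) (restrict-chain p p₀ ps refl (R-gadget p≢p₀) refl) r)
      chain-repeat p (p′ ∷ ps) (there p₀∈ps) r = chain-repeat p′ ps p₀∈ps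
        (NoRepeat-++ʳ _≟_ (R (pieces p′ gadget)) (NoRepeat-++ʳ _≟_ (R (others p p′))
          (subst (NoRepeat _≟_) (restrict-chain p p′ ps refl refl refl) r)))

    module _ (p₀ : Fin t) where

      open SamePair p₀

      chain-avoiding-pair : ∀ p ps → p₀ ≢ p → All (p₀ ≢_) ps → ∃ λ v → R (chain p ps) ≡ y ∷ x ∷ v
      chain-avoiding-pair p []        p₀≢p []           = _ , restrict-chain-[] p (R-others-out p₀≢p p₀≢p) refl
      chain-avoiding-pair p (p′ ∷ ps) p₀≢p (p₀≢p′ ∷ _) = _ , restrict-chain p p′ ps (R-others-out p₀≢p p₀≢p′) refl refl

      -- The leading `x` ends the preceding stretch yx. Every stretch passed on the way ends in `x`
      -- again, until the gadget xyxy of `p₀` follows directly and gives xx.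
      chain-through-pair : ∀ p ps → p₀ ≢ p → Unique ps → p₀ ∈ ps → ¬ NoRepeat _≟_ (x ∷ R (chain p ps))
      chain-through-pair p (.p₀ ∷ ps) p₀≢p u (here refl) r = repeat-absurd _≟_ []
        (subst (NoRepeat _≟_) (cong (x ∷_) (restrict-chain p p₀ ps (R-others-in (inj₂ refl)) R-gadget refl)) r)
      chain-through-pair p (p′ ∷ ps) p₀≢p (p′∉ ∷ u) (there p₀∈ps) r =
        chain-through-pair p′ ps p₀≢p′ u p₀∈ps (NoRepeat-++ʳ _≟_ (x ∷ y ∷ [])
          (subst (NoRepeat _≟_) (cong (x ∷_) (restrict-chain p p′ ps (R-others-out p₀≢p p₀≢p′) (R-gadget-other p₀≢p′) refl)) r))
        where
        p₀≢p′ : p₀ ≢ p′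
        p₀≢p′ = ≢-sym (All.lookup p′∉ p₀∈ps)

      -- On the two members x, y of a pair, the gadget of the pair contributes xyxy; each
      -- stretch between gadgets contributes yx or nothing, and yx occurs because there are two pairs.
      chain-repeat-pair : ∀ p₂ ps → Unique (p₁ ∷ p₂ ∷ ps) → p₀ ∈ p₁ ∷ p₂ ∷ ps
        → ¬ Alternate _≟_ x y (chain p₁ (p₁ ∷ p₂ ∷ ps))
      chain-repeat-pair p₂ ps ((p₁≢p₂ ∷ p₁∉) ∷ u) (here refl) r =
        repeat-absurd _≟_ (x ∷ y ∷ x ∷ []) (subst (NoRepeat _≟_)
          (restrict-chain p₁ p₁ (p₂ ∷ ps) (R-others-in (inj₁ refl)) R-gadget
            (restrict-chain p₁ p₂ ps (R-others-in (inj₁ refl)) (R-gadget-other p₁≢p₂)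
              (proj₂ (chain-avoiding-pair p₂ ps p₁≢p₂ p₁∉)))) r)
      chain-repeat-pair p₂ ps (p₁∉ ∷ u) (there p₀∈ps) r =
        chain-through-pair p₁ (p₂ ∷ ps) p₀≢p₁ u p₀∈ps (NoRepeat-tail _≟_ (subst (NoRepeat _≟_)
          (restrict-chain p₁ p₁ (p₂ ∷ ps) (R-others-out p₀≢p₁ p₀≢p₁) (R-gadget-other p₀≢p₁) refl) r))
        where
        p₀≢p₁ : p₀ ≢ p₁
        p₀≢p₁ = ≢-sym (All.lookup p₁∉ p₀∈ps)

    module _ {q q′ : Fin n} (q≢q′ : q ≢ q′) where

      open Second q q′ q≢q′

      -- The leading `u`, `v` are the trace of the latest gadget. The end of the word reads vu, so
      -- somewhere the order switches from uv to vu, and there `v` is repeated, since stretches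
      -- contribute nothing.
      chain-order : ∀ {u v} → R (pieces p₁ classesʳ) ≡ v ∷ u ∷ []
        → (∀ p → R (pieces p gadget) ≡ u ∷ v ∷ [] ⊎ R (pieces p gadget) ≡ v ∷ u ∷ [])
        → ∀ p ps → ¬ NoRepeat _≟_ (u ∷ v ∷ R (chain p ps))
      chain-order {u} {v} end once p [] r = repeat-absurd _≟_ [ u ]
        (subst (NoRepeat _≟_) (cong (λ w → u ∷ v ∷ w) (restrict-chain-[] p (R-others p p) end)) r)
      chain-order {u} {v} end once p (p′ ∷ ps) r with once p′
      ... | inj₂ e = repeat-absurd _≟_ [ u ]
        (subst (NoRepeat _≟_) (cong (λ w → u ∷ v ∷ w) (restrict-chain p p′ ps (R-others p p′) e refl)) r)
      ... | inj₁ e = chain-order end once p′ ps (NoRepeat-++ʳ _≟_ (u ∷ v ∷ [])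
        (subst (NoRepeat _≟_) (cong (λ w → u ∷ v ∷ w) (restrict-chain p p′ ps (R-others p p′) e refl)) r))

      R-gadget-once : ∀ p → R (pieces p gadget) ≡ x ∷ y ∷ [] ⊎ R (pieces p gadget) ≡ y ∷ x ∷ []
      R-gadget-once p = Data.Sum.map (trans (R-gadget p)) (trans (R-gadget p)) (R-classes p)

      chain-second : ∀ ps → ¬ Alternate _≟_ x y (chain p₁ (p₁ ∷ ps))
      chain-second ps r with R-classes p₁
      ... | inj₁ e = chain-order (trans (R-classesʳ p₁) (cong reverse e)) R-gadget-once p₁ ps
        (subst (NoRepeat _≟_) (restrict-chain p₁ p₁ ps (R-others p₁ p₁) (trans (R-gadget p₁) e) refl) r)
      ... | inj₂ e = chain-order (trans (R-classesʳ p₁) (cong reverse e)) (swap ∘ R-gadget-once) p₁ ps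
        (subst (NoRepeat _≟_) (restrict-chain p₁ p₁ ps (R-others p₁ p₁) (trans (R-gadget p₁) e) refl) r)

    chain-good : Fin n → ∀ p₂ ps → Unique (p₁ ∷ p₂ ∷ ps) → (∀ p → p ∈ p₁ ∷ p₂ ∷ ps)
      → Good (suc (suc (suc (length ps)))) (chain p₁ (p₁ ∷ p₂ ∷ ps))
    chain-good q₀ p₂ ps u all = record
      -- Occurrences are counted in a restriction to one letter of each part; the partner is
      -- arbitrary, `q₀` for the first part and a member of `p₁` for the second.
      { uniform = λ { (inj₁ (p , c)) → split-occˡ p c q₀ w (split p c q₀)
                    ; (inj₂ q) → split-occʳ p₁ true q w (split p₁ true q) }
      ; cross   = λ { (p , c) q → split-cross p c q w (split p c q) }
      ; first   = not-first
      ; second  = λ q q′ q≢q′ → chain-second q≢q′ (p₂ ∷ ps)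
      }
      where
      w : List V
      w = chain p₁ (p₁ ∷ p₂ ∷ ps)

      split : ∀ p c q → Split p c q (suc (suc (length ps))) w
      split p c q = chain-split p c q (p₂ ∷ ps) u (all p)

      not-first : ∀ s s′ → s ≢ s′ → ¬ Alternate _≟_ (inj₁ s) (inj₁ s′) w
      not-first (p , c) (p′ , c′) s≢s′ r with p′ ≟ᶠ p
      not-first (p , c) (p′ , c′) s≢s′ r | no p′≢p = chain-repeat p c (p′ , c′) p′≢p p₁ (p₁ ∷ p₂ ∷ ps) (all p) r
      not-first (p , false) (p , false) s≢s′ r | yes refl = s≢s′ refl
      not-first (p , false) (p , true)  s≢s′ r | yes refl = chain-repeat-pair p p₂ ps u (all p) r
      not-first (p , true)  (p , false) s≢s′ r | yes refl =
        chain-repeat-pair p p₂ ps u (all p) (alternate-sym _≟_ {inj₁ (p , true)} {w = w} r)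
      not-first (p , true)  (p , true)  s≢s′ r | yes refl = s≢s′ refl

  -- The word for a single pair.

  module OnePair (p₁ : Fin t) (unique : ∀ p → p ≡ p₁) where

    word : List V
    word = pieces p₁ solo

    word-cross : ∀ c q → Pattern₂ (inj₁ (p₁ , c)) (inj₂ q) (M (p₁ , c) q) (restrict _≟_ (inj₁ (p₁ , c)) (inj₂ q) word)
    word-cross c q = subst₂ (Pattern₂ x y) (sym M-choose) (sym (R-pieces solo))
      (spell-solo c (M (p₁ , false) q) (M (p₁ , true) q) x y)
      where open Cross p₁ c q

    -- The slots of `solo` read a a a′ a′, beginning with a repetition.
    word-first : ¬ Alternate _≟_ (inj₁ (p₁ , false)) (inj₁ (p₁ , true)) word
    word-first r = repeat-absurd _≟_ [] (subst (NoRepeat _≟_) (R-pieces solo) r)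
      where open SamePair p₁

    word-second : ∀ {q q′} → q ≢ q′ → ¬ Alternate _≟_ (inj₂ q) (inj₂ q′) word
    word-second {q} {q′} q≢q′ r = absurd (R-classes p₁)
      where
      open Second q q′ q≢q′
      -- With slots erased, the word is a list followed by its reversal, so its two middle letters
      -- coincide.
      R-word : R word ≡ R (pieces p₁ classes) ++ reverse (R (pieces p₁ classes))
      R-word = trans (R-pieces p₁ solo)
        (trans (concatMap-++ (interpret (const []) λ c d → R (neighbours p₁ c d)) classes classesʳ)
               (cong₂ _++_ (sym (R-pieces p₁ classes)) (trans (sym (R-pieces p₁ classesʳ)) (R-classesʳ p₁))))
      absurd : R (pieces p₁ classes) ≡ x ∷ y ∷ [] ⊎ R (pieces p₁ classes) ≡ y ∷ x ∷ [] → ⊥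
      absurd (inj₁ e) = repeat-absurd _≟_ [ x ] (subst (NoRepeat _≟_) (trans R-word (cong (λ u → u ++ reverse u) e)) r)
      absurd (inj₂ e) = repeat-absurd _≟_ [ y ] (subst (NoRepeat _≟_) (trans R-word (cong (λ u → u ++ reverse u) e)) r)

    word-good : Fin n → Good 2 word
    word-good q₀ = record
      { uniform = λ { (inj₁ (p , c)) → occ-first p c ; (inj₂ q) → occ-second q }
      ; cross   = λ { (p , c) q → iff p c q }
      ; first   = not-first
      ; second  = λ q q′ → word-second
      }
      where
      x≢y : ∀ {s q} → inj₁ s ≢ inj₂ q
      x≢y ()

      occ-first : ∀ p c → occ _≟_ (inj₁ (p , c)) word ≡ 2
      occ-first p c with refl ← unique p =
        trans (sym (occ-restrictˡ _≟_ (inj₁ (p , c)) (inj₂ q₀) word)) (Pattern₂-occˡ _≟_ x≢y (word-cross c q₀))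

      occ-second : ∀ q → occ _≟_ (inj₂ q) word ≡ 2
      occ-second q =
        trans (sym (occ-restrictʳ _≟_ (inj₁ (p₁ , true)) (inj₂ q) word)) (Pattern₂-occʳ _≟_ x≢y (word-cross true q))

      iff : ∀ p c q → M (p , c) q ≡ true ⇔ Alternate _≟_ (inj₁ (p , c)) (inj₂ q) word
      iff p c q with refl ← unique p = Pattern₂-alternate _≟_ x≢y (word-cross c q)

      not-first : ∀ s s′ → s ≢ s′ → ¬ Alternate _≟_ (inj₁ s) (inj₁ s′) word
      not-first (p , c) (p′ , c′) s≢s′ r with unique p | unique p′
      not-first (p , false) (p , false) s≢s′ r | refl | refl = s≢s′ refl
      not-first (p , false) (p , true)  s≢s′ r | refl | refl = word-first r
      not-first (p , true)  (p , false) s≢s′ r | refl | refl = word-first (alternate-sym _≟_ {inj₁ (p , true)} {w = word} r)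
      not-first (p , true)  (p , true)  s≢s′ r | refl | refl = s≢s′ refl

good-word : ∀ {t n} (M : Fin (suc t) × Bool → Fin n → Bool) → Fin n
  → ∃ (Construction.Good M (suc (suc t)))
good-word {zero}  M q₀ = _ , word-good q₀
  where
  only-zero : (p : Fin 1) → p ≡ zero
  only-zero zero = refl
  open Construction.OnePair M zero only-zero
-- `allFin (suc (suc t))` unfolds to two explicit pairs and a tabulated rest of length `t`, the
-- shape that `chain-good` takes.
good-word {suc t} M q₀ = w , subst (λ k → Construction.Good M (suc (suc (suc k))) w) (length-tabulate {n = t} _)
  (chain-good q₀ (suc zero) (tabulate λ i → suc (suc i)) (allFin⁺ (suc (suc t))) ∈-allFin)
  where
  open Construction.Chain M zero
  w = chain zero (allFin (suc (suc t)))

-- Deleting letters outside the image of an injection.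

module Preimage {V W : Set} (_≟ⱽ_ : DecidableEquality V) (_≟ᵂ_ : DecidableEquality W)
  (f : W → V) (f-injective : ∀ {a b} → f a ≡ f b → a ≡ b) (f? : ∀ v → Dec (∃ λ a → f a ≡ v)) where

  preimage : List V → List W
  preimage []      = []
  preimage (v ∷ w) with f? v
  ... | yes (a , _) = a ∷ preimage w
  ... | no _        = preimage w

  -- `P` holds only on the image of `f`, so the letters lost in `preimage` are ones that `P?`
  -- discards anyway. Hence deletion preserves occurrence counts and alternation of the remaining
  -- letters.
  filter-preimage : {P : V → Set} {Q : W → Set} (P? : Decidable P) (Q? : Decidable Q)
    → (∀ {a} → Q a → P (f a)) → (∀ {a} → P (f a) → Q a) → (∀ {v} → P v → ∃ λ a → f a ≡ v)
    → ∀ w → map f (filter Q? (preimage w)) ≡ filter P? w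
  filter-preimage P? Q? to from image []      = refl
  filter-preimage P? Q? to from image (v ∷ w) with f? v
  ... | no ∄a = trans (filter-preimage P? Q? to from image w) (sym (filter-reject P? (∄a ∘ image)))
  ... | yes (a , refl) with Q? a
  ...   | yes Qa = trans (cong (f a ∷_) (filter-preimage P? Q? to from image w)) (sym (filter-accept P? (to Qa)))
  ...   | no ¬Qa = trans (filter-preimage P? Q? to from image w) (sym (filter-reject P? (¬Qa ∘ from)))

  occ-preimage : ∀ a w → occ _≟ᵂ_ a (preimage w) ≡ occ _≟ⱽ_ (f a) w
  occ-preimage a w = trans (sym (length-map f (filter (_≟ᵂ a) (preimage w))))
    (cong length (filter-preimage (_≟ⱽ f a) (_≟ᵂ a) (cong f) f-injective (λ e → a , sym e) w))

  restrict-preimage : ∀ a b w → map f (restrict _≟ᵂ_ a b (preimage w)) ≡ restrict _≟ⱽ_ (f a) (f b) w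
  restrict-preimage a b = filter-preimage (λ z → (z ≟ⱽ f a) ⊎-dec (z ≟ⱽ f b)) (λ z → (z ≟ᵂ a) ⊎-dec (z ≟ᵂ b))
    (Data.Sum.map (cong f) (cong f)) (Data.Sum.map f-injective f-injective)
    [ (λ e → a , sym e) , (λ e → b , sym e) ]′

  NoRepeat-map⁺ : ∀ {l} → NoRepeat _≟ᵂ_ l → NoRepeat _≟ⱽ_ (map f l)
  NoRepeat-map⁺ nil          = nil
  NoRepeat-map⁺ (one a)      = one (f a)
  NoRepeat-map⁺ (cons a≢b r) = cons (a≢b ∘ f-injective) (NoRepeat-map⁺ r)

  NoRepeat-map⁻ : ∀ l → NoRepeat _≟ⱽ_ (map f l) → NoRepeat _≟ᵂ_ l
  NoRepeat-map⁻ []          r            = nil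
  NoRepeat-map⁻ (a ∷ [])    r            = one a
  NoRepeat-map⁻ (a ∷ b ∷ l) (cons a≢b r) = cons (a≢b ∘ cong f) (NoRepeat-map⁻ (b ∷ l) r)

  alternate-preimage⁺ : ∀ {a b} w → Alternate _≟ⱽ_ (f a) (f b) w → Alternate _≟ᵂ_ a b (preimage w)
  alternate-preimage⁺ {a} {b} w r = NoRepeat-map⁻ _ (subst (NoRepeat _≟ⱽ_) (sym (restrict-preimage a b w)) r)

  alternate-preimage⁻ : ∀ {a b} w → Alternate _≟ᵂ_ a b (preimage w) → Alternate _≟ⱽ_ (f a) (f b) w
  alternate-preimage⁻ {a} {b} w r = subst (NoRepeat _≟ⱽ_) (restrict-preimage a b w) (NoRepeat-map⁺ r)

-- Splitting the first part into pairs and transferring the word.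

pairing : ∀ {m t} → .(m ≤ t * 2) → Fin m → Fin t × Bool
-- Quotient and remainder on division by 2: the quotient is the pair, the remainder selects the
-- member.
pairing {t = t} m≤2t i = map₂ (Inverse.to 2↔Bool) (remQuot {t} 2 (inject≤ i m≤2t))

pairing-injective : ∀ {m t} .(m≤2t : m ≤ t * 2) {i j} → pairing {t = t} m≤2t i ≡ pairing m≤2t j → i ≡ j
pairing-injective {t = t} m≤2t {i} {j} e = inject≤-injective m≤2t m≤2t i j
  (trans (sym (combine-remQuot {t} 2 (inject≤ i m≤2t)))
  (trans (cong (uncurry Data.Fin.combine) (cong₂ _,_ (cong proj₁ e) (Injection.injective (↔⇒↣ 2↔Bool) (cong proj₂ e))))
         (combine-remQuot {t} 2 (inject≤ j m≤2t))))

bipartite-rep : ∀ {m n} t (B : Fin m → Fin n → Bool) → m ≤ suc t * 2 → Fin n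
  → HasUniformRep biVertex-≟ (BipartiteGraph B) (suc (suc t))
bipartite-rep {m} {n} t B m≤ q₀ = preimage w , uniform′ , (λ x → occurs⇒∈ biVertex-≟ (preimage w) (uniform′ x)) , represents
  where
  f : Fin m → Fin (suc t) × Bool
  f = pairing m≤

  f? : ∀ s → Dec (∃ λ i → f i ≡ s)
  f? s = any? (λ i → ×-≡-dec _≟ᶠ_ _≟ᵇ_ (f i) s)

  -- Slots that carry no vertex get an isolated dummy vertex, deleted again by preimage.
  extend : ∀ {s} → Dec (∃ λ i → f i ≡ s) → Fin n → Bool
  extend (yes (i , _)) q = B i q
  extend (no _)        q = false

  M : Fin (suc t) × Bool → Fin n → Bool
  M s = extend (f? s)

  M-f : ∀ i q → M (f i) q ≡ B i q
  M-f i q with f? (f i)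
  ... | yes (j , e) = cong (λ i → B i q) (pairing-injective m≤ e)
  ... | no ∄i       = contradiction (i , refl) ∄i

  open Construction M using (V; _≟_)

  F : BiVertex m n → V
  F = Data.Sum.map f id

  F-injective : ∀ {a b} → F a ≡ F b → a ≡ b
  F-injective {inj₁ i} {inj₁ j} e = cong inj₁ (pairing-injective m≤ (inj₁-inj e))
  F-injective {inj₂ i} {inj₂ j} e = cong inj₂ (inj₂-inj e)

  F? : ∀ v → Dec (∃ λ a → F a ≡ v)
  F? (inj₂ q) = yes (inj₂ q , refl)
  F? (inj₁ s) = map′ (λ { (i , e) → inj₁ i , cong inj₁ e }) (λ { (inj₁ i , e) → i , inj₁-inj e }) (f? s)

  open Preimage _≟_ biVertex-≟ F F-injective F?

  w : List V
  w = proj₁ (good-word M q₀)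

  open Construction.Good (proj₂ (good-word M q₀))

  uniform′ : Uniform biVertex-≟ (suc (suc t)) (preimage w)
  uniform′ a = trans (occ-preimage a w) (uniform (F a))

  cross⁺ : ∀ i q → B i q ≡ true → Alternate _≟_ (F (inj₁ i)) (F (inj₂ q)) w
  cross⁺ i q e = Equivalence.to (cross (f i) q) (trans (M-f i q) e)

  cross⁻ : ∀ i q → Alternate _≟_ (F (inj₁ i)) (F (inj₂ q)) w → B i q ≡ true
  cross⁻ i q a = trans (sym (M-f i q)) (Equivalence.from (cross (f i) q) a)

  represents : ∀ a b → a ≢ b → biAdj B a b ≡ true ⇔ Alternate biVertex-≟ a b (preimage w)
  represents (inj₁ i) (inj₁ j) i≢j = mk⇔ (λ ()) λ r →
    contradiction (alternate-preimage⁻ w r) (first (f i) (f j) (λ e → i≢j (cong inj₁ (pairing-injective m≤ e))))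
  represents (inj₁ i) (inj₂ q) _ = mk⇔ (λ e → alternate-preimage⁺ w (cross⁺ i q e))
    (λ r → cross⁻ i q (alternate-preimage⁻ w r))
  represents (inj₂ q) (inj₁ i) _ = mk⇔
    (λ e → alternate-preimage⁺ w (alternate-sym _≟_ {F (inj₁ i)} {w = w} (cross⁺ i q e)))
    (λ r → cross⁻ i q (alternate-sym _≟_ {F (inj₂ q)} {w = w} (alternate-preimage⁻ w r)))
  represents (inj₂ q) (inj₂ q′) q≢q′ = mk⇔ (λ ()) λ r →
    contradiction (alternate-preimage⁻ w r) (second q q′ (q≢q′ ∘ cong inj₂))

-- Deciding uniform representability and finding the least exponent.

module Search {V : Set} (_≟_ : DecidableEquality V)
  (∃? : {P : V → Set} → Decidable P → Dec (∃ P)) (vs : List V) (∈-vs : ∀ v → v ∈ vs) where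

  ∀? : {P : V → Set} → Decidable P → Dec (∀ v → P v)
  ∀? P? = map′ (λ ∄¬P v → decidable-stable (P? v) λ ¬Pv → ∄¬P (v , ¬Pv)) (λ { ∀P (v , ¬Pv) → ¬Pv (∀P v) })
               (¬? (∃? (¬? ∘ P?)))

  NoRepeat? : Decidable (NoRepeat _≟_)
  NoRepeat? []          = yes nil
  NoRepeat? (x ∷ [])    = yes (one x)
  NoRepeat? (x ∷ y ∷ w) = map′ (uncurry cons) (λ { (cons x≢y r) → x≢y , r }) (¬? (x ≟ y) ×-dec NoRepeat? (y ∷ w))

  short? : ∀ L {P : List V → Set} → Decidable P → Dec (∃ λ w → length w ≤ L × P w)
  short? zero    P? = map′ (λ P[] → [] , z≤n , P[]) (λ { ([] , _ , P[]) → P[] }) (P? [])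
  short? (suc L) {P} P? = map′ to from (P? [] ⊎-dec ∃? (λ v → short? L (P? ∘ (v ∷_))))
    where
    to : P [] ⊎ (∃ λ v → ∃ λ w → length w ≤ L × P (v ∷ w)) → ∃ λ w → length w ≤ suc L × P w
    to (inj₁ P[])               = [] , z≤n , P[]
    to (inj₂ (v , w , l , Pvw)) = v ∷ w , s≤s l , Pvw
    from : (∃ λ w → length w ≤ suc L × P w) → P [] ⊎ (∃ λ v → ∃ λ w → length w ≤ L × P (v ∷ w))
    from ([]    , _     , P[]) = inj₁ P[]
    from (v ∷ w , s≤s l , Pvw) = inj₂ (v , w , l , Pvw)

  occ-∷-≤ : ∀ x v w → occ _≟_ x w ≤ occ _≟_ x (v ∷ w)
  occ-∷-≤ x v w with does (v ≟ x)
  ... | true  = n≤1+n _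
  ... | false = ≤-refl

  sum-occ-mono : ∀ v w us → sum (map (λ x → occ _≟_ x w) us) ≤ sum (map (λ x → occ _≟_ x (v ∷ w)) us)
  sum-occ-mono v w []       = z≤n
  sum-occ-mono v w (u ∷ us) = +-mono-≤ (occ-∷-≤ u v w) (sum-occ-mono v w us)

  -- Prepending `v` raises its own count and lowers none. The list may contain a vertex more than
  -- once, so only an inequality is claimed.
  sum-occ-< : ∀ {v} w {us} → v ∈ us → sum (map (λ x → occ _≟_ x w) us) < sum (map (λ x → occ _≟_ x (v ∷ w)) us)
  sum-occ-< {v} w {_ ∷ us} (here refl) = +-mono-≤ (≤-reflexive (sym (occ-hit _≟_ {v} {w} refl))) (sum-occ-mono v w us)
  sum-occ-< {v} w {u ∷ us} (there v∈) = ≤-trans (≤-reflexive (sym (+-suc _ _))) (+-mono-≤ (occ-∷-≤ u v w) (sum-occ-< w v∈))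

  length≤sum-occ : ∀ w → length w ≤ sum (map (λ x → occ _≟_ x w) vs)
  length≤sum-occ []      = z≤n
  length≤sum-occ (v ∷ w) = ≤-trans (s≤s (length≤sum-occ w)) (sum-occ-< w (∈-vs v))

  -- The right side is `k` times the length of `vs`, so the search for a `k`-uniform word is finite.
  uniform-length : ∀ {k} w → Uniform _≟_ k w → length w ≤ sum (map (const k) vs)
  uniform-length w u = subst (λ l → length w ≤ sum l) (map-cong u vs) (length≤sum-occ w)

  HasUniformRep? : ∀ G k → Dec (HasUniformRep _≟_ G k)
  HasUniformRep? G k = map′ (λ { (w , _ , r) → w , r }) (λ { (w , u , r) → w , uniform-length w u , u , r })
    (short? (sum (map (const k) vs)) λ w → ∀? (λ x → occ _≟_ x w ≟ⁿ k) ×-dec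
      ∀? (λ x → x ∈? w) ×-dec
      ∀? (λ x → ∀? λ y → ¬? (x ≟ y) →-dec
        map′ (uncurry mk⇔) (λ e → Equivalence.to e , Equivalence.from e)
          (((adj G x y ≟ᵇ true) →-dec NoRepeat? (restrict _≟_ x y w))
            ×-dec (NoRepeat? (restrict _≟_ x y w) →-dec (adj G x y ≟ᵇ true)))))
    where open import Data.List.Membership.DecPropositional _≟_ using (_∈?_)

-- A representation number must be attained and minimal; it is reached by testing 0, 1, 2 and so on,
-- shifting the predicate after each failure, and the known witness `b` ends the search.
least : {P : ℕ → Set} → Decidable P → ∀ b → P b → ∃ λ r → (P r × (∀ k → P k → r ≤ k)) × r ≤ b
least P? b       Pb with P? 0
least P? b       Pb | yes P0 = 0 , (P0 , λ _ _ → z≤n) , z≤n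
least P? zero    Pb | no ¬P0 = contradiction Pb ¬P0
least {P} P? (suc b) Pb | no ¬P0 with r , (Pr , min) , r≤b ← least (P? ∘ suc) b Pb =
  suc r , (Pr , min′) , s≤s r≤b
  where
  min′ : ∀ k → P k → suc r ≤ k
  min′ zero    P0 = contradiction P0 ¬P0
  min′ (suc k) Pk = s≤s (min k Pk)

repNumber≤ : ∀ {m n} (G : Graph (BiVertex m n)) b → HasUniformRep biVertex-≟ G b
  → ∃[ r ] (IsRepNumber biVertex-≟ G r × r ≤ b)
repNumber≤ {m} {n} G = least (HasUniformRep? G)
  where
  ∃? : {P : BiVertex m n → Set} → Decidable P → Dec (∃ P)
  ∃? P? = map′ [ (λ { (i , p) → inj₁ i , p }) , (λ { (i , p) → inj₂ i , p }) ]′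
               (λ { (inj₁ i , p) → inj₁ (i , p) ; (inj₂ i , p) → inj₂ (i , p) })
               (any? (P? ∘ inj₁) ⊎-dec any? (P? ∘ inj₂))

  vertices : List (BiVertex m n)
  vertices = map inj₁ (allFin m) ++ map inj₂ (allFin n)

  ∈-vertices : ∀ v → v ∈ vertices
  ∈-vertices (inj₁ i) = ∈-++⁺ˡ (∈-map⁺ inj₁ (∈-allFin i))
  ∈-vertices (inj₂ i) = ∈-++⁺ʳ (map inj₁ (allFin m)) (∈-map⁺ inj₂ (∈-allFin i))

  open Search biVertex-≟ ∃? vertices ∈-vertices

-- Counting pairs against the bound.

half : ∀ m → ∃ λ t → m ≡ t * 2 ⊎ m ≡ suc (t * 2)
half zero          = 0 , inj₁ refl
half (suc zero)    = 0 , inj₂ refl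
half (suc (suc m)) with half m
... | t , inj₁ refl = suc t , inj₁ refl
... | t , inj₂ refl = suc t , inj₂ refl

-- Applied with `N = m + n + 3`: the ceiling of a quarter of m + n is `N / 4` rounded down.
quarter-bound : ∀ {k N} → k * 4 ≤ N → k ≤ N / 4
quarter-bound {k} {N} h = subst (_≤ N / 4) (m*n/n≡m k 4) (/-monoˡ-≤ 4 h)

rep-count : ∀ {m n} → (suc m + 3 ≤ n) ⊎ (2 ∣ suc m × ((n ≡ suc m + 1) ⊎ (n ≡ suc m + 2)))
  → ∃ λ t → suc m ≤ suc t * 2 × suc (suc t) ≤ (suc m + n + 3) / 4
-- Halving `m` instead of `suc m` gives a first part of size 2t + 1 or 2t + 2, so t + 1 pairs
-- suffice in both cases.
rep-count {m} {n} (inj₁ m+3≤n) with half m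
-- One slot stays empty. With n at least 2t + 4 the estimate 4(t + 2) = (2t + 1) + (2t + 4) + 3 is
-- exact.
... | t , inj₁ refl = t , n≤1+n _ , quarter-bound (≤-trans
  (≤-reflexive (solve 1 (λ t → (con 2 :+ t) :* con 4 := (con 1 :+ t :* con 2) :+ (con 1 :+ t :* con 2 :+ con 3) :+ con 3) refl t))
  (+-monoˡ-≤ 3 (+-monoʳ-≤ (suc m) m+3≤n)))
  where open +-*-Solver
... | t , inj₂ refl = t , ≤-refl , quarter-bound (≤-trans
  (m≤m+n _ 2)
  (≤-trans (≤-reflexive (solve 1 (λ t → (con 2 :+ t) :* con 4 :+ con 2 := (con 2 :+ t :* con 2) :+ (con 2 :+ t :* con 2 :+ con 3) :+ con 3) refl t))
  (+-monoˡ-≤ 3 (+-monoʳ-≤ (suc m) m+3≤n))))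
  where open +-*-Solver
-- No slot is empty, so n = 2t + 3 already gives 4(t + 2); the next case has one unit to spare.
rep-count (inj₂ (divides (suc t) refl , inj₁ refl)) = t , ≤-refl , quarter-bound (≤-reflexive
  (solve 1 (λ t → (con 2 :+ t) :* con 4 := (con 2 :+ t :* con 2) :+ (con 2 :+ t :* con 2 :+ con 1) :+ con 3) refl t))
  where open +-*-Solver
rep-count (inj₂ (divides (suc t) refl , inj₂ refl)) = t , ≤-refl , quarter-bound (≤-trans (n≤1+n _) (≤-reflexive
  (solve 1 (λ t → con 1 :+ (con 2 :+ t) :* con 4 := (con 2 :+ t :* con 2) :+ (con 2 :+ t :* con 2 :+ con 2) :+ con 3) refl t)))
  where open +-*-Solver

-- The empty first part, and the conclusion.

edgeless-disconnected : ∀ {n} (B : Fin 0 → Fin (suc (suc n)) → Bool) → ¬ Connected (BipartiteGraph B)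
edgeless-disconnected B conn with conn (inj₂ zero) (inj₂ (suc zero))
... | step {y = inj₁ ()} _ _
... | step {y = inj₂ _} () _

single-vertex-rep : (B : Fin 0 → Fin 1 → Bool) → HasUniformRep biVertex-≟ (BipartiteGraph B) 1
single-vertex-rep B = [ inj₂ zero ] , (λ { (inj₂ zero) → refl })
  , (λ { (inj₂ zero) → here refl })
  , λ { (inj₂ zero) (inj₂ zero) v≢v → contradiction refl v≢v }

theorem2 : (m n : ℕ) (B : Fin m → Fin n → Bool) → m ≤ n
    → Connected (BipartiteGraph B) → Reduced (BipartiteGraph B)
    → ((m + 3 ≤ n)
    ⊎ (2 ∣ m × ((n ≡ m + 1) ⊎ (n ≡ m + 2))))
    → ∃[ r ] (IsRepNumber biVertex-≟ (BipartiteGraph B) r × r ≤ (m + n + 3) / 4)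
theorem2 zero 0 B _ _ _ (inj₁ ())
theorem2 zero 0 B _ _ _ (inj₂ (_ , inj₁ ()))
theorem2 zero 0 B _ _ _ (inj₂ (_ , inj₂ ()))
-- The bound `(0 + 1 + 3) / 4` evaluates to 1.
theorem2 zero 1 B _ _ _ _ = repNumber≤ (BipartiteGraph B) 1 (single-vertex-rep B)
theorem2 zero (suc (suc n)) B _ conn _ _ = contradiction conn (edgeless-disconnected B)
theorem2 (suc m) (suc n) B _ _ _ h with t , m≤ , k≤ ← rep-count h
  with r , rep , r≤k ← repNumber≤ (BipartiteGraph B) _ (bipartite-rep t B m≤ zero) = r , rep , ≤-trans r≤k k≤
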